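{- Let $L$ be a bounded lattice and $\otimes$ a t-norm on $L$ that is both $\wedge$-distributive and $\vee$-distributive and such that $\langle L,\otimes\rangle$ is divisible. Let $k_1,k_2\in\mathbb{N}^*$ and let $F_1,F_2:L^2\to L$ be such that, for $i=1,2$, $F_i$ is $\otimes^{k_i}$-homogeneous, has $1_L$ as neutral element and satisfies $F_i(x,y)=F_i(x\wedge y,x\vee y)$ for all $x,y\in L$. If $k_1\ge k_2$, then $F_1(x,y)\le_LF_2(x,y)$ for all $x,y\in L$.
   Context: A t-norm on $L$ is a commutative, associative map $L^2\to L$, non-decreasing in each argument, with neutral element $1_L$; $\wedge$-distributive: $x\otimes(y\wedge z)=(x\otimes y)\wedge(x\otimes z)$; $\vee$-distributive: $x\otimes(y\vee z)=(x\otimes y)\vee(x\otimes z)$. $\langle L,\otimes\rangle$ is divisible if for all $y\le_Lx$ there is $z$ with $y=x\otimes z$. Powers: $\lambda_\otimes^{(0)}=1_L$, $\lambda_\otimes^{(1)}=\lambda$, $\lambda_\otimes^{(m)}=\lambda\otimes\lambda_\otimes^{(m-1)}$ for $m\ge2$. $F$ is $\otimes^k$-homogeneous if $F(\lambda\otimes x,\lambda\otimes y)=\lambda_\otimes^{(k)}\otimes F(x,y)$ for all $\lambda,x,y$. $1_L$ is neutral for $F$ if $F(x,1_L)=F(1_L,x)=x$ for all $x$. -}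

module Defs where

open import Algebra.Core using (Op₂)
open import Algebra.Structures using (IsCommutativeMonoid)
open import Data.Nat.Base using (ℕ; zero; suc)
open import Data.Product.Base using (∃-syntax)
open import Level using (Level; _⊔_)
open import Relation.Binary.Definitions using (LeftMonotonic; RightMonotonic)
open import Relation.Binary.Lattice.Bundles using (BoundedLattice)

module OnBoundedLattice {c ℓ₁ ℓ₂ : Level} (L : BoundedLattice c ℓ₁ ℓ₂) where

  open BoundedLattice L

  -- Maps L² → L are curried operations Op₂ Carrier. The library's lattices
  -- carry a setoid equality _≈_, so "map" means an operation that also
  -- respects _≈_; for t-norms this is part of IsCommutativeMonoid.

  record IsTNorm (_⊗_ : Op₂ Carrier) : Set (c ⊔ ℓ₁ ⊔ ℓ₂) where
    field
      isCommutativeMonoid : IsCommutativeMonoid _≈_ _⊗_ ⊤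
      monoˡ               : LeftMonotonic _≤_ _≤_ _⊗_
      monoʳ               : RightMonotonic _≤_ _≤_ _⊗_

    open IsCommutativeMonoid isCommutativeMonoid public
      using (assoc; comm; identity; identityˡ; identityʳ; ∙-cong; ∙-congˡ; ∙-congʳ)

  Divisible : Op₂ Carrier → Set (c ⊔ ℓ₁ ⊔ ℓ₂)
  Divisible _⊗_ = ∀ x y → y ≤ x → ∃[ z ] y ≈ (x ⊗ z)

  power : Op₂ Carrier → Carrier → ℕ → Carrier
  power _⊗_ a zero          = ⊤
  power _⊗_ a (suc zero)    = a
  power _⊗_ a (suc (suc m)) = a ⊗ power _⊗_ a (suc m)

  Homogeneous : Op₂ Carrier → ℕ → Op₂ Carrier → Set (c ⊔ ℓ₁)
  Homogeneous _⊗_ k F =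
    ∀ a x y → F (a ⊗ x) (a ⊗ y) ≈ (power _⊗_ a k ⊗ F x y)

  MeetJoinInvariant : Op₂ Carrier → Set (c ⊔ ℓ₁)
  MeetJoinInvariant F = ∀ x y → F x y ≈ F (x ∧ y) (x ∨ y)

{-# OPTIONS --safe #-}

-- Writing x ∧ y = (x ∨ y) ⊗ z by divisibility and x ∨ y = (x ∨ y) ⊗ ⊤, homogeneity
-- gives Fᵢ(x, y) = (x ∨ y)^(kᵢ) ⊗ Fᵢ(z, ⊤) = (x ∨ y)^(kᵢ) ⊗ z with the same z for
-- both i, and powers of a t-norm decrease as the exponent grows.
module Submission where

open import Defs
open import Algebra.Core using (Op₂)
open import Algebra.Definitions using (Congruent₂; Identity; _DistributesOverˡ_)
open import Data.Nat.Base using (ℕ; zero; suc; NonZero; _≥_; _≤′_; ≤′-refl; ≤′-step)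
open import Data.Nat.Properties using (≤⇒≤′)
open import Data.Product.Base using (_,_; proj₂)
open import Level using (Level)
open import Relation.Binary.Lattice.Bundles using (BoundedLattice)
import Relation.Binary.Reasoning.PartialOrder as ≤-Reasoning
import Relation.Binary.Reasoning.Setoid as ≈-Reasoning

module _ {c ℓ₁ ℓ₂ : Level} (L : BoundedLattice c ℓ₁ ℓ₂) where

  open BoundedLattice L
  open OnBoundedLattice L

  module TNorm {_⊗_ : Op₂ Carrier} (isTNorm : IsTNorm _⊗_) where

    open IsTNorm isTNorm

    -- `⊤` is both the greatest element and neutral for `_⊗_`: raising the left factor from `a` to
    -- `⊤` gives the bound.
    a⊗b≤b : ∀ a b → (a ⊗ b) ≤ b
    a⊗b≤b a b = trans (monoʳ b (maximum a)) (reflexive (identityˡ b))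

    -- Exponent one has its own clause in `power`, so for `m = 0` the recursion holds only up to
    -- `_≈_`, by right neutrality of `⊤`.
    power-suc : ∀ a m → power _⊗_ a (suc m) ≈ (a ⊗ power _⊗_ a m)
    power-suc a zero    = Eq.sym (identityʳ a)
    power-suc a (suc m) = Eq.refl

    -- Each `≤′-step` multiplies the larger power by one more factor `a`, which can only lower it.
    power-antitone : ∀ a {m n} → m ≤′ n → power _⊗_ a n ≤ power _⊗_ a m
    power-antitone a ≤′-refl               = refl
    power-antitone a (≤′-step {n = n} m≤n) =
      trans (reflexive (power-suc a n))
        (trans (a⊗b≤b a (power _⊗_ a n)) (power-antitone a m≤n))

    -- The value depends on `F` only through `k`. The quotient `z` is a parameter, so that a single
    -- choice of it serves two different functions.
    homogeneous-value : ∀ {F} k → Congruent₂ _≈_ F → Homogeneous _⊗_ k F →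
      Identity _≈_ ⊤ F → MeetJoinInvariant F →
      ∀ x y {z} → (x ∧ y) ≈ ((x ∨ y) ⊗ z) → F x y ≈ (power _⊗_ (x ∨ y) k ⊗ z)
    homogeneous-value {F} k F-cong F-homo F-id F-inv x y {z} x∧y≈ = begin
      F x y                            ≈⟨ F-inv x y ⟩
      F (x ∧ y) (x ∨ y)                ≈⟨ F-cong x∧y≈ (Eq.sym (identityʳ (x ∨ y))) ⟩
      F ((x ∨ y) ⊗ z) ((x ∨ y) ⊗ ⊤)    ≈⟨ F-homo (x ∨ y) z ⊤ ⟩
      power _⊗_ (x ∨ y) k ⊗ F z ⊤      ≈⟨ ∙-congˡ (proj₂ F-id z) ⟩
      power _⊗_ (x ∨ y) k ⊗ z          ∎
      where open ≈-Reasoning setoid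

mainTheorem13 :
    {c ℓ₁ ℓ₂ : Level} (L : BoundedLattice c ℓ₁ ℓ₂) →
    let open BoundedLattice L
        open OnBoundedLattice L in
    (_⊗_ : Op₂ Carrier) →
    IsTNorm _⊗_ →
    _DistributesOverˡ_ _≈_ _⊗_ _∧_ →
    _DistributesOverˡ_ _≈_ _⊗_ _∨_ →
    Divisible _⊗_ →
    (k₁ k₂ : ℕ) → .{{_ : NonZero k₁}} → .{{_ : NonZero k₂}} →
    (F₁ F₂ : Op₂ Carrier) →
    Congruent₂ _≈_ F₁ → Congruent₂ _≈_ F₂ →
    Homogeneous _⊗_ k₁ F₁ → Homogeneous _⊗_ k₂ F₂ →
    Identity _≈_ ⊤ F₁ → Identity _≈_ ⊤ F₂ →
    MeetJoinInvariant F₁ → MeetJoinInvariant F₂ →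
    k₁ ≥ k₂ →
    ∀ x y → F₁ x y ≤ F₂ x y
mainTheorem13 L _⊗_ isTNorm _ _ divisible k₁ k₂ F₁ F₂ cong₁ cong₂ homo₁ homo₂
  id₁ id₂ inv₁ inv₂ k₁≥k₂ x y =
  -- Divisibility applies because `x ∧ y ≤ x ≤ x ∨ y`.
  let z , x∧y≈ = divisible (x ∨ y) (x ∧ y) (trans (x∧y≤x x y) (x≤x∨y x y)) in
  begin
  F₁ x y                     ≈⟨ homogeneous-value k₁ cong₁ homo₁ id₁ inv₁ x y x∧y≈ ⟩
  -- `monoʳ z` keeps the right factor `z` fixed and compares the two powers on the left.
  power _⊗_ (x ∨ y) k₁ ⊗ z   ≤⟨ monoʳ z (power-antitone (x ∨ y) (≤⇒≤′ k₁≥k₂)) ⟩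
  power _⊗_ (x ∨ y) k₂ ⊗ z   ≈⟨ homogeneous-value k₂ cong₂ homo₂ id₂ inv₂ x y x∧y≈ ⟨
  F₂ x y                     ∎
  where
  open BoundedLattice L
  open OnBoundedLattice L
  open IsTNorm isTNorm using (monoʳ)
  open TNorm L isTNorm
  open ≤-Reasoning poset
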